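{- Let $f$ be a linear polynomial over $\mathbb{Q}$ which depends on $n$ variables (i.e. has exactly $n$ variables with nonzero coefficients) and satisfies $0\notin im_2(f)$. Then every tree-like $\mathrm{Res}(\mathrm{lin}_{\mathbb{Q}})$ refutation of the linear clause $f=0$ has size $2^{\Omega(\sqrt{n})}$.
   Context: $im_2(f)$ denotes the set of values of $f$ under all 0-1 assignments to its variables. A linear clause over a ring $R$ is a disjunction $(f_1=0)\vee\dots\vee(f_k=0)$ of linear equations with linear forms $f_j=\sum_i a_ix_i+b$ over $R$ (duplicate disjuncts identified); the empty clause stands for false; variables range over $\{0,1\}$. The proof system $\mathrm{Res}(\mathrm{lin}_R)$ has the boolean axioms $x=0\vee x=1$ for every variable $x$ and the rules: resolution (from $C\vee f=0$ and $D\vee g=0$ derive $C\vee D\vee(\alpha f+\beta g=0)$, $\alpha,\beta\in R$), simplification (from $C\vee a=0$ with $a\in R\setminus\{0\}$ a constant derive $C$), weakening (from $C$ derive $C\vee f=0$). A refutation of a set $\phi$ of linear clauses is a sequence of linear clauses ending in the empty clause, each in $\phi$, a boolean axiom, or obtained from earlier ones by a rule. It is tree-like if every occurrence of a clause is used at most once as a premise. Size is the total number of variable occurrences plus the total bit-size of all coefficients. -}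

module Defs where

open import Data.Nat as ℕ using (ℕ; zero; suc)
open import Data.Nat.Logarithm using (⌊log₂_⌋)
open import Data.Integer as ℤ using (ℤ)
open import Data.Rational as ℚ using (ℚ; 0ℚ; 1ℚ; ↥_; ↧ₙ_)
open import Data.Rational.Properties using (_≟_)
open import Data.Fin using (Fin)
open import Data.Vec using (Vec; []; _∷_; zipWith; replicate; tabulate)
open import Data.List using (List; []; _∷_; _++_; [_])
open import Data.List.Membership.Propositional using (_∈_)
open import Data.Bool using (Bool; true; false; if_then_else_)
open import Data.Product using (_×_; _,_; proj₁; proj₂)
open import Relation.Nullary using (¬_; yes; no)
open import Relation.Binary.PropositionalEquality using (_≡_; _≢_)

-- A linear form over ℚ in the variables x_0,...,x_{m-1}:
-- (coefficient vector a, constant b) representing  Σ a_i x_i + b.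
Form : ℕ → Set
Form m = Vec ℚ m × ℚ

coeffs : ∀ {m} → Form m → Vec ℚ m
coeffs = proj₁

const : ∀ {m} → Form m → ℚ
const = proj₂

evalVec : ∀ {m} → Vec ℚ m → Vec Bool m → ℚ
evalVec [] [] = 0ℚ
evalVec (a ∷ as) (x ∷ xs) = (if x then a else 0ℚ) ℚ.+ evalVec as xs

eval : ∀ {m} → Form m → Vec Bool m → ℚ
eval (as , b) xs = evalVec as xs ℚ.+ b

ZeroNotInIm₂ : ∀ {m} → Form m → Set
ZeroNotInIm₂ {m} f = (xs : Vec Bool m) → eval f xs ≢ 0ℚ

countNZ : ∀ {m} → Vec ℚ m → ℕ
countNZ [] = 0
countNZ (a ∷ as) with a ≟ 0ℚ
... | yes _ = countNZ as
... | no _ = suc (countNZ as)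

nvars : ∀ {m} → Form m → ℕ
nvars f = countNZ (coeffs f)

lincomb : ∀ {m} → ℚ → Form m → ℚ → Form m → Form m
lincomb α (as , b) β (cs , d) =
  zipWith (λ u v → α ℚ.* u ℚ.+ β ℚ.* v) as cs , α ℚ.* b ℚ.+ β ℚ.* d

NonzeroConst : ∀ {m} → Form m → Set
NonzeroConst {m} (as , b) = (as ≡ replicate m 0ℚ) × (b ≢ 0ℚ)

varForm : ∀ {m} → Fin m → ℚ → Form m
varForm i b = tabulate (λ j → indicator i j) , b
  where
  open import Data.Fin using () renaming (_≟_ to _≟F_)
  indicator : ∀ {m} → Fin m → Fin m → ℚ
  indicator i j with i ≟F j
  ... | yes _ = 1ℚ
  ... | no _ = 0ℚ

-- A linear clause: disjunction of equations f = 0, as a list of forms;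
-- duplicates identified via set-equality of clauses.
Clause : ℕ → Set
Clause m = List (Form m)

record _≈ₛ_ {m} (C D : Clause m) : Set where
  field
    to   : ∀ {f} → f ∈ C → f ∈ D
    from : ∀ {f} → f ∈ D → f ∈ C

-- Tree-like Res(lin_ℚ) derivations from a set φ of linear clauses.
-- A derivation tree of clause E; each node's clause is used exactly once.
data Deriv {m} (φ : List (Clause m)) : Clause m → Set where
  axiom : ∀ {C E} → C ∈ φ → E ≈ₛ C → Deriv φ E
  boolean : ∀ {E} (i : Fin m) →
    E ≈ₛ (varForm i 0ℚ ∷ varForm i (ℚ.- 1ℚ) ∷ []) → Deriv φ E
  resolution : ∀ {P Q C D f g E} (α β : ℚ) →
    Deriv φ P → P ≈ₛ (C ++ [ f ]) →
    Deriv φ Q → Q ≈ₛ (D ++ [ g ]) →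
    E ≈ₛ (C ++ D ++ [ lincomb α f β g ]) → Deriv φ E
  simplification : ∀ {P C a E} →
    Deriv φ P → P ≈ₛ (C ++ [ a ]) → NonzeroConst a → E ≈ₛ C → Deriv φ E
  weakening : ∀ {P f E} → Deriv φ P → E ≈ₛ (P ++ [ f ]) → Deriv φ E

bitsℕ : ℕ → ℕ
bitsℕ n = suc ⌊log₂ n ⌋

bitsℚ : ℚ → ℕ
bitsℚ q = bitsℕ (ℤ.∣ ↥ q ∣) ℕ.+ bitsℕ (↧ₙ q)

-- (number of variable occurrences, bit-size of nonzero variable coefficients)
sizeCoeffs : ∀ {m} → Vec ℚ m → ℕ
sizeCoeffs [] = 0
sizeCoeffs (a ∷ as) with a ≟ 0ℚ
... | yes _ = sizeCoeffs as
... | no _ = suc (bitsℚ a) ℕ.+ sizeCoeffs as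

sizeForm : ∀ {m} → Form m → ℕ
sizeForm (as , b) = sizeCoeffs as ℕ.+ bitsℚ b

sizeClause : ∀ {m} → Clause m → ℕ
sizeClause [] = 0
sizeClause (f ∷ C) = sizeForm f ℕ.+ sizeClause C

size : ∀ {m} {φ : List (Clause m)} {E} → Deriv φ E → ℕ
size {E = E} (axiom _ _) = sizeClause E
size {E = E} (boolean _ _) = sizeClause E
size {E = E} (resolution _ _ d _ e _ _) = sizeClause E ℕ.+ size d ℕ.+ size e
size {E = E} (simplification d _ _ _) = sizeClause E ℕ.+ size d
size {E = E} (weakening d _) = sizeClause E ℕ.+ size d

TreeRefutation : ∀ {m} → List (Clause m) → Set
TreeRefutation φ = Deriv φ []

{-# OPTIONS --safe #-}

-- Evaluate the refutation at points p of the hyperplane f = 0 that are boolean in all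
-- coordinates but one, j.  A clause is falsified by p if all its forms are nonzero at p; from
-- the root such a p can be traced to a leaf, which must be the boolean axiom of x_j.  Delayer
-- plays on the sets of these points, earning a coin whenever both premises of a resolution
-- step remain possible; k coins force size 2 ^ k.  Modulo f, a promised disequality h ≠ 0
-- either has small support, and its variables are fixed so that h is a nonzero constant, or has
-- support larger than twice the number of promises.  Forms of the latter kind never cover the
-- cube (Linial and Radhakrishnan): if q vanishes at a vertex y where the other r forms do not,
-- more than r of the flips at y change q in the same direction, and a polynomial of degree r
-- nonzero at y is nonzero at another vertex of the subcube they span (Alon and Füredi).
-- Each coin costs O(k) variables, hence about √n coins are earned.

module Submission where

open import Defs
open import Data.Nat as ℕ using (ℕ; zero; suc; pred; _≤_; _<_; _+_; _*_; _^_; z≤n; s≤s)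
import Data.Nat.Properties as ℕₚ
open import Data.Nat.Tactic.RingSolver using (solve-∀)
open import Data.Bool using (Bool; true; false; not; _∧_)
import Data.Bool.Properties as Boolₚ
open import Data.Fin using (Fin; zero; suc)
import Data.Fin.Properties as Finₚ
open import Data.Fin.Subset
  using (Subset; inside; outside; ∣_∣; _∈_; _∉_; _⊆_; _∪_; _─_; Nonempty; ⊤; ⁅_⁆)
open import Data.Fin.Subset.Properties
  using (_∈?_; nonempty?; Empty-unique; p⊆q⇒∣p∣≤∣q∣; x∈p∪q⁺; x∈p∧x∉q⇒x∈p─q; p─q⊆p;
         x∈⁅x⁆; x∈⁅y⁆⇒x≡y; ∣⁅x⁆∣≡1; ∣⊥∣≡0)
open import Data.List using (List; []; _∷_; length; map; _++_; [_])
import Data.List.Properties as Listₚ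
import Data.List.Membership.Propositional as List∈
open import Data.List.Membership.Propositional.Properties using (∈-++⁻; ∈-++⁺ˡ; ∈-++⁺ʳ)
import Data.List.Relation.Unary.Any as Any
open import Data.List.Relation.Unary.All as All using (All; []; _∷_)
import Data.List.Relation.Unary.All.Properties as Allₚ
open import Data.List.Relation.Binary.Permutation.Propositional
  using (_↭_; ↭-refl; ↭-sym; ↭-trans; prep; swap)
open import Data.List.Relation.Binary.Permutation.Propositional.Properties
  using (All-resp-↭; ↭-length)
open import Data.Product using (_×_; _,_; proj₁; proj₂; ∃-syntax; uncurry)
open import Data.Rational as ℚ using (ℚ; 0ℚ; 1ℚ)
import Data.Rational.Properties as ℚₚ
open import Data.Rational.Solver using (module +-*-Solver)
open import Data.Sum using (_⊎_; inj₁; inj₂; [_,_]′)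
import Data.Unit as Unit
open import Data.Vec as Vec
  using (Vec; []; _∷_; lookup; tabulate; replicate; _[_]≔_; here; there)
import Data.Vec.Properties as Vecₚ
open import Function using (_∘_)
open import Relation.Binary using (tri<; tri≈; tri>)
open import Relation.Binary.PropositionalEquality
  using (_≡_; _≢_; _≗_; refl; sym; trans; cong; cong₂; subst; subst₂; module ≡-Reasoning)
open import Relation.Nullary using (Dec; yes; no; does; ¬_; contradiction)
open import Relation.Nullary.Decidable using (dec-true; ¬?; _×-dec_; decidable-stable)
open import Relation.Unary using (Decidable)

private variable m : ℕ

-- Zero and nonzero rationals.

p*q≡0⇒q≡0 : ∀ {p q} → p ≢ 0ℚ → p ℚ.* q ≡ 0ℚ → q ≡ 0ℚ
p*q≡0⇒q≡0 {p} {q} p≢0 pq≡0 = begin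
  q                     ≡⟨ ℚₚ.*-identityˡ q ⟨
  1ℚ ℚ.* q              ≡⟨ cong (ℚ._* q) (ℚₚ.*-inverseˡ p) ⟨
  ℚ.1/ p ℚ.* p ℚ.* q    ≡⟨ ℚₚ.*-assoc (ℚ.1/ p) p q ⟩
  ℚ.1/ p ℚ.* (p ℚ.* q)  ≡⟨ cong (ℚ.1/ p ℚ.*_) pq≡0 ⟩
  ℚ.1/ p ℚ.* 0ℚ         ≡⟨ ℚₚ.*-zeroʳ (ℚ.1/ p) ⟩
  0ℚ                    ∎
  where
  open ≡-Reasoning
  instance
    p-nonZero : ℚ.NonZero p
    p-nonZero = ℚ.≢-nonZero p≢0

*-≢0 : ∀ {p q} → p ≢ 0ℚ → q ≢ 0ℚ → p ℚ.* q ≢ 0ℚ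
*-≢0 p≢0 q≢0 pq≡0 = q≢0 (p*q≡0⇒q≡0 p≢0 pq≡0)

p-q≡0⇒p≡q : ∀ p q → p ℚ.- q ≡ 0ℚ → p ≡ q
p-q≡0⇒p≡q p q p-q≡0 = begin
  p              ≡⟨ solve 2 (λ p q → p := p :- q :+ q) refl p q ⟩
  p ℚ.- q ℚ.+ q  ≡⟨ cong (ℚ._+ q) p-q≡0 ⟩
  0ℚ ℚ.+ q       ≡⟨ ℚₚ.+-identityˡ q ⟩
  q              ∎
  where
  open ≡-Reasoning
  open +-*-Solver

-≢0 : ∀ p q → p ℚ.- q ≢ 0ℚ → p ≢ 0ℚ ⊎ q ≢ 0ℚ
-≢0 p q p-q≢0 with p ℚₚ.≟ 0ℚ | q ℚₚ.≟ 0ℚ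
... | no p≢0   | _        = inj₁ p≢0
... | yes _    | no q≢0   = inj₂ q≢0
... | yes refl | yes refl = contradiction refl p-q≢0

≢0⇒≢0⊎-≢0 : ∀ p q → q ≢ 0ℚ → p ≢ 0ℚ ⊎ p ℚ.- q ≢ 0ℚ
≢0⇒≢0⊎-≢0 p q q≢0 with p ℚₚ.≟ 0ℚ
... | no  p≢0 = inj₁ p≢0
... | yes p≡0 = inj₂ λ p-q≡0 → q≢0 (trans (sym (p-q≡0⇒p≡q p q p-q≡0)) p≡0)

-- Evaluation of forms at rational points

dot : Vec ℚ m → Vec ℚ m → ℚ
dot []       []       = 0ℚ
dot (a ∷ as) (x ∷ xs) = a ℚ.* x ℚ.+ dot as xs

evalAt : Form m → Vec ℚ m → ℚ
evalAt (as , b) xs = dot as xs ℚ.+ b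

coeff : Form m → Fin m → ℚ
coeff f = lookup (coeffs f)

𝟙 : Bool → ℚ
𝟙 false = 0ℚ
𝟙 true  = 1ℚ

𝟙-not-≢ : ∀ b → 𝟙 (not b) ℚ.- 𝟙 b ≢ 0ℚ
𝟙-not-≢ false ()
𝟙-not-≢ true  ()

vertex : Vec Bool m → Vec ℚ m
vertex = Vec.map 𝟙

evalAt-lincomb : ∀ α (f : Form m) β g xs →
  evalAt (lincomb α f β g) xs ≡ α ℚ.* evalAt f xs ℚ.+ β ℚ.* evalAt g xs
evalAt-lincomb α ([] , b) β ([] , d) [] =
  solve 4 (λ α b β d → con 0ℚ :+ (α :* b :+ β :* d)
                    := α :* (con 0ℚ :+ b) :+ β :* (con 0ℚ :+ d)) refl α b β d
  where open +-*-Solver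
evalAt-lincomb α (a ∷ as , b) β (c ∷ cs , d) (x ∷ xs) = begin
  (α ℚ.* a ℚ.+ β ℚ.* c) ℚ.* x ℚ.+ r ℚ.+ k
    ≡⟨ ℚₚ.+-assoc ((α ℚ.* a ℚ.+ β ℚ.* c) ℚ.* x) r k ⟩
  (α ℚ.* a ℚ.+ β ℚ.* c) ℚ.* x ℚ.+ (r ℚ.+ k)
    ≡⟨ cong ((α ℚ.* a ℚ.+ β ℚ.* c) ℚ.* x ℚ.+_) (evalAt-lincomb α (as , b) β (cs , d) xs) ⟩
  (α ℚ.* a ℚ.+ β ℚ.* c) ℚ.* x ℚ.+ (α ℚ.* (s ℚ.+ b) ℚ.+ β ℚ.* (t ℚ.+ d))
    ≡⟨ solve 9 (λ α a β c x s b t d →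
          (α :* a :+ β :* c) :* x :+ (α :* (s :+ b) :+ β :* (t :+ d))
          := α :* (a :* x :+ s :+ b) :+ β :* (c :* x :+ t :+ d)) refl α a β c x s b t d ⟩
  α ℚ.* (a ℚ.* x ℚ.+ s ℚ.+ b) ℚ.+ β ℚ.* (c ℚ.* x ℚ.+ t ℚ.+ d) ∎
  where
  open ≡-Reasoning
  open +-*-Solver
  r = dot (coeffs (lincomb α (as , b) β (cs , d))) xs
  k = α ℚ.* b ℚ.+ β ℚ.* d
  s = dot as xs
  t = dot cs xs

dot-cong : ∀ (as xs ys : Vec ℚ m) →
  (∀ l → lookup as l ≡ 0ℚ ⊎ lookup xs l ≡ lookup ys l) → dot as xs ≡ dot as ys
dot-cong []       []       []       _ = refl
dot-cong (a ∷ as) (x ∷ xs) (y ∷ ys) h =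
  cong₂ ℚ._+_ (head (h zero)) (dot-cong as xs ys (h ∘ suc))
  where
  head : a ≡ 0ℚ ⊎ x ≡ y → a ℚ.* x ≡ a ℚ.* y
  head (inj₁ refl) = trans (ℚₚ.*-zeroˡ x) (sym (ℚₚ.*-zeroˡ y))
  head (inj₂ refl) = refl

dot-mono-≤ : ∀ (as xs ys : Vec ℚ m) →
  (∀ l → lookup as l ℚ.* lookup xs l ℚ.≤ lookup as l ℚ.* lookup ys l) →
  dot as xs ℚ.≤ dot as ys
dot-mono-≤ []       []       []       _ = ℚₚ.≤-refl
dot-mono-≤ (a ∷ as) (x ∷ xs) (y ∷ ys) h =
  ℚₚ.+-mono-≤ (h zero) (dot-mono-≤ as xs ys (h ∘ suc))

dot-mono-< : ∀ (as xs ys : Vec ℚ m) →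
  (∀ l → lookup as l ℚ.* lookup xs l ℚ.≤ lookup as l ℚ.* lookup ys l) →
  ∀ l → lookup as l ℚ.* lookup xs l ℚ.< lookup as l ℚ.* lookup ys l →
  dot as xs ℚ.< dot as ys
dot-mono-< (a ∷ as) (x ∷ xs) (y ∷ ys) h zero    lt =
  ℚₚ.+-mono-<-≤ lt (dot-mono-≤ as xs ys (h ∘ suc))
dot-mono-< (a ∷ as) (x ∷ xs) (y ∷ ys) h (suc l) lt =
  ℚₚ.+-mono-≤-< (h zero) (dot-mono-< as xs ys (h ∘ suc) l lt)

-- Low-degree functions on subcubes

-- Low T y r F: on the subcube of points agreeing with y outside T, the function F is a
-- polynomial of degree less than r (for r = 0: it vanishes).
Low : Subset m → Vec Bool m → ℕ → (Vec Bool m → ℚ) → Set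
Low []            []      zero    F = F [] ≡ 0ℚ
Low []            []      (suc r) F = Unit.⊤
Low (outside ∷ T) (b ∷ y) r       F = Low T y r (F ∘ (b ∷_))
Low (inside  ∷ T) (b ∷ y) r       F =
  Low T y r (F ∘ (b ∷_)) × Low T y (pred r) (λ z → F (not b ∷ z) ℚ.- F (b ∷ z))

Low-cong : ∀ (T : Subset m) y r {F G} → F ≗ G → Low T y r F → Low T y r G
Low-cong []            []      zero    eq p       = trans (sym (eq [])) p
Low-cong []            []      (suc r) eq p       = p
Low-cong (outside ∷ T) (b ∷ y) r       eq p       = Low-cong T y r (eq ∘ (b ∷_)) p
Low-cong (inside  ∷ T) (b ∷ y) r       eq (p , q) =
  Low-cong T y r (eq ∘ (b ∷_)) p ,
  Low-cong T y (pred r) (λ z → cong₂ ℚ._-_ (eq (not b ∷ z)) (eq (b ∷ z))) q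

Low-suc : ∀ (T : Subset m) y r {F} → Low T y r F → Low T y (suc r) F
Low-suc []            []      r       p       = _
Low-suc (outside ∷ T) (b ∷ y) r       p       = Low-suc T y r p
Low-suc (inside  ∷ T) (b ∷ y) zero    (p , q) = Low-suc T y zero p , q
Low-suc (inside  ∷ T) (b ∷ y) (suc r) (p , q) = Low-suc T y (suc r) p , Low-suc T y r q

Low-≤ : ∀ (T : Subset m) y {r s F} → r ℕ.≤′ s → Low T y r F → Low T y s F
Low-≤ T y ℕ.≤′-refl       p = p
Low-≤ T y (ℕ.≤′-step r≤s) p = Low-suc T y _ (Low-≤ T y r≤s p)

Low-+ : ∀ (T : Subset m) y r {F G} →
  Low T y r F → Low T y r G → Low T y r (λ z → F z ℚ.+ G z)
Low-+ []            []      zero    p q = cong₂ ℚ._+_ p q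
Low-+ []            []      (suc r) p q = _
Low-+ (outside ∷ T) (b ∷ y) r       p q = Low-+ T y r p q
Low-+ (inside  ∷ T) (b ∷ y) r {F} {G} (p , p′) (q , q′) =
  Low-+ T y r p q ,
  Low-cong T y (pred r)
    (λ z → solve 4 (λ f₁ f₀ g₁ g₀ → (f₁ :- f₀) :+ (g₁ :- g₀) := (f₁ :+ g₁) :- (f₀ :+ g₀))
             refl (F (not b ∷ z)) (F (b ∷ z)) (G (not b ∷ z)) (G (b ∷ z)))
    (Low-+ T y (pred r) p′ q′)
  where open +-*-Solver

Low-scale : ∀ (T : Subset m) y r c {F} → Low T y r F → Low T y r (λ z → c ℚ.* F z)
Low-scale []            []      zero    c p = trans (cong (c ℚ.*_) p) (ℚₚ.*-zeroʳ c)
Low-scale []            []      (suc r) c p = _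
Low-scale (outside ∷ T) (b ∷ y) r       c p = Low-scale T y r c p
Low-scale (inside  ∷ T) (b ∷ y) r       c {F} (p , q) =
  Low-scale T y r c p ,
  Low-cong T y (pred r)
    (λ z → solve 3 (λ c f₁ f₀ → c :* (f₁ :- f₀) := c :* f₁ :- c :* f₀)
             refl c (F (not b ∷ z)) (F (b ∷ z)))
    (Low-scale T y (pred r) c q)
  where open +-*-Solver

Low-0 : ∀ (T : Subset m) y r → Low T y r (λ _ → 0ℚ)
Low-0 []            []      zero    = refl
Low-0 []            []      (suc r) = _
Low-0 (outside ∷ T) (b ∷ y) r       = Low-0 T y r
Low-0 (inside  ∷ T) (b ∷ y) r       = Low-0 T y r , Low-0 T y (pred r)

Low-const : ∀ (T : Subset m) y c → Low T y 1 (λ _ → c)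
Low-const []            []      c = _
Low-const (outside ∷ T) (b ∷ y) c = Low-const T y c
Low-const (inside  ∷ T) (b ∷ y) c =
  Low-const T y c , Low-cong T y 0 (λ _ → sym (ℚₚ.+-inverseʳ c)) (Low-0 T y 0)

-- Degree less than 0 means vanishing on the whole subcube, which survives multiplication by an
-- arbitrary function.
Low-zero-* : ∀ (T : Subset m) y (G : Vec Bool m → ℚ) {F} →
  Low T y 0 F → Low T y 0 (λ z → G z ℚ.* F z)
Low-zero-* []            []      G p = trans (cong (G [] ℚ.*_) p) (ℚₚ.*-zeroʳ (G []))
Low-zero-* (outside ∷ T) (b ∷ y) G p = Low-zero-* T y (G ∘ (b ∷_)) p
Low-zero-* (inside  ∷ T) (b ∷ y) G {F} (p , q) =
  Low-zero-* T y (G ∘ (b ∷_)) p ,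
  Low-cong T y 0
    (λ z → solve 4 (λ g₁ g₀ f₁ f₀ → g₁ :* (f₁ :- f₀) :+ (g₁ :- g₀) :* f₀
                                   := g₁ :* f₁ :- g₀ :* f₀)
             refl (G (not b ∷ z)) (G (b ∷ z)) (F (not b ∷ z)) (F (b ∷ z)))
    (Low-+ T y 0 (Low-zero-* T y (G ∘ (not b ∷_)) q)
                 (Low-zero-* T y (λ z → G (not b ∷ z) ℚ.- G (b ∷ z)) p))
  where open +-*-Solver

evalAt-∷ : ∀ a (as : Vec ℚ m) c x xs →
  evalAt (as , a ℚ.* x ℚ.+ c) xs ≡ evalAt (a ∷ as , c) (x ∷ xs)
evalAt-∷ a as c x xs =
  solve 3 (λ d t c → d :+ (t :+ c) := t :+ d :+ c) refl (dot as xs) (a ℚ.* x) c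
  where open +-*-Solver

-- Discrete product rule: with subscripts for the two faces, the difference of `q * F` is
-- `q₁ * (F₁ - F₀) + (q₁ - q₀) * F₀`, where `q₁ - q₀` is a constant.
Low-linear-* : ∀ (T : Subset m) y r (q : Form m) {F} →
  Low T y r F → Low T y (suc r) (λ z → evalAt q (vertex z) ℚ.* F z)
Low-linear-* []            []      r q             p = _
Low-linear-* (outside ∷ T) (b ∷ y) r (a ∷ as , c) {F} p =
  Low-cong T y (suc r) (λ z → cong (ℚ._* F (b ∷ z)) (evalAt-∷ a as c (𝟙 b) (vertex z)))
    (Low-linear-* T y r (as , a ℚ.* 𝟙 b ℚ.+ c) p)
Low-linear-* (inside  ∷ T) (b ∷ y) r q@(a ∷ as , c) {F} (p , p′) =
  Low-cong T y (suc r) (λ z → cong (ℚ._* F (b ∷ z)) (evalAt-∷ a as c (𝟙 b) (vertex z)))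
    (Low-linear-* T y r (as , a ℚ.* 𝟙 b ℚ.+ c) p) ,
  Low-cong T y r
    (λ z → solve 7 (λ d a x₁ x₀ c f₁ f₀ →
                 (d :+ (a :* x₁ :+ c)) :* (f₁ :- f₀) :+ (a :* x₁ :- a :* x₀) :* f₀
              := (a :* x₁ :+ d :+ c) :* f₁ :- (a :* x₀ :+ d :+ c) :* f₀)
             refl (dot as (vertex z)) a (𝟙 (not b)) (𝟙 b) c (F (not b ∷ z)) (F (b ∷ z)))
    (Low-+ T y r (first r p′) (Low-scale T y r (a ℚ.* 𝟙 (not b) ℚ.- a ℚ.* 𝟙 b) p))
  where
  open +-*-Solver
  q₁ : Form _
  q₁ = as , a ℚ.* 𝟙 (not b) ℚ.+ c
  -- `suc (pred r)` equals `r` only for positive `r`; for `r = 0` the difference of `F` vanishes,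
  -- and so does its product with `q₁`.
  first : ∀ r → Low T y (pred r) (λ z → F (not b ∷ z) ℚ.- F (b ∷ z)) →
          Low T y r (λ z → evalAt q₁ (vertex z) ℚ.* (F (not b ∷ z) ℚ.- F (b ∷ z)))
  first zero    = Low-zero-* T y (evalAt q₁ ∘ vertex)
  first (suc r) = Low-linear-* T y r q₁

_≗_off_ : Vec Bool m → Vec Bool m → Subset m → Set
z ≗ y off T = ∀ l → l ∉ T → lookup z l ≡ lookup y l

off-outside : ∀ {b} {T : Subset m} {y z} → z ≗ y off T → (b ∷ z) ≗ (b ∷ y) off (outside ∷ T)
off-outside agree zero    _   = refl
off-outside agree (suc l) l∉T = agree l (l∉T ∘ there)

off-inside : ∀ {b c} {T : Subset m} {y z} → z ≗ y off T → (c ∷ z) ≗ (b ∷ y) off (inside ∷ T)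
off-inside agree zero    l∉T = contradiction here l∉T
off-inside agree (suc l) l∉T = agree l (l∉T ∘ there)

-- A polynomial of degree less than ∣ T ∣ on a ∣ T ∣-dimensional cube cannot be nonzero at
-- exactly one vertex.
Low⇒second-nonzero : ∀ (T : Subset m) y F → Low T y ∣ T ∣ F → F y ≢ 0ℚ →
  ∃[ z ] (z ≗ y off T × (∃[ l ] lookup z l ≢ lookup y l) × F z ≢ 0ℚ)
Low⇒second-nonzero []            []      F p Fy≢0 = contradiction p Fy≢0
Low⇒second-nonzero (outside ∷ T) (b ∷ y) F p Fy≢0
  with z , agree , (l , diff) , Fz≢0 ← Low⇒second-nonzero T y (F ∘ (b ∷_)) p Fy≢0 =
  b ∷ z , off-outside agree , (suc l , diff) , Fz≢0
Low⇒second-nonzero (inside ∷ T) (b ∷ y) F (_ , q) Fy≢0 =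
  -- Either the neighbour of `y` across the new coordinate is a nonzero, or the difference of the
  -- two faces is nonzero at `y`. That difference has degree one less, so it has a second nonzero,
  -- and there one of the faces is nonzero.
  [ (λ F₁y≢0 → not b ∷ y , off-inside (λ _ _ → refl) ,
               (zero , λ eq → Boolₚ.not-¬ eq refl) , F₁y≢0)
  , (λ Gy≢0 → lift (Low⇒second-nonzero T y _ q Gy≢0))
  ]′ (≢0⇒≢0⊎-≢0 (F (not b ∷ y)) (F (b ∷ y)) Fy≢0)
  where
  Goal : Vec Bool _ → Set
  Goal v = v ≗ (b ∷ y) off (inside ∷ T) × (∃[ l ] lookup v l ≢ lookup (b ∷ y) l) × F v ≢ 0ℚ
  lift : ∃[ z ] (z ≗ y off T × (∃[ l ] lookup z l ≢ lookup y l) ×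
                 F (not b ∷ z) ℚ.- F (b ∷ z) ≢ 0ℚ) → ∃[ v ] Goal v
  lift (z , agree , (l , diff) , Gz≢0) =
    [ (λ F₁z≢0 → not b ∷ z , off-inside agree , (suc l , diff) , F₁z≢0)
    , (λ F₀z≢0 → b ∷ z , off-inside agree , (suc l , diff) , F₀z≢0)
    ]′ (-≢0 (F (not b ∷ z)) (F (b ∷ z)) Gz≢0)

values-product : List (Form m) → Vec Bool m → ℚ
values-product []       z = 1ℚ
values-product (q ∷ qs) z = evalAt q (vertex z) ℚ.* values-product qs z

Low-product : ∀ (T : Subset m) y qs → Low T y (suc (length qs)) (values-product qs)
Low-product T y []       = Low-const T y 1ℚ
Low-product T y (q ∷ qs) = Low-linear-* T y (suc (length qs)) q (Low-product T y qs)

NonzeroAt : Vec ℚ m → Form m → Set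
NonzeroAt p q = evalAt q p ≢ 0ℚ

product-≢0⁺ : ∀ {qs : List (Form m)} {z} → All (NonzeroAt (vertex z)) qs → values-product qs z ≢ 0ℚ
product-≢0⁺ []         ()
product-≢0⁺ (nz ∷ nzs) = *-≢0 nz (product-≢0⁺ nzs)

product-≢0⁻ : ∀ (qs : List (Form m)) {z} → values-product qs z ≢ 0ℚ → All (NonzeroAt (vertex z)) qs
product-≢0⁻ []       _  = []
product-≢0⁻ (q ∷ qs) {z} nz =
  (λ eq → nz (trans (cong (ℚ._* values-product qs z) eq) (ℚₚ.*-zeroˡ (values-product qs z)))) ∷
  product-≢0⁻ qs
    (λ eq → nz (trans (cong (evalAt q (vertex z) ℚ.*_) eq) (ℚₚ.*-zeroʳ (evalAt q (vertex z)))))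

-- The product of the forms is a polynomial of degree at most `length qs`, nonzero exactly where all
-- of them are.
avoid-zeros : ∀ (T : Subset m) y qs → length qs < ∣ T ∣ → All (NonzeroAt (vertex y)) qs →
  ∃[ z ] (z ≗ y off T × (∃[ l ] lookup z l ≢ lookup y l) × All (NonzeroAt (vertex z)) qs)
avoid-zeros T y qs r<∣T∣ nz
  with z , agree , diff , nz′ ← Low⇒second-nonzero T y (values-product qs)
         (Low-≤ T y (ℕₚ.≤⇒≤′ r<∣T∣) (Low-product T y qs)) (product-≢0⁺ nz) =
  z , agree , diff , product-≢0⁻ qs nz′

-- Subsets cut out by a decidable predicate

module _ {P : Fin m → Set} (P? : Decidable P) where

  select : Subset m → Subset m
  select U = tabulate (λ l → lookup U l ∧ does (P? l))

  select⁺ : ∀ {U l} → l ∈ U → P l → l ∈ select U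
  select⁺ {U} {l} l∈U pl = Vecₚ.lookup⇒[]= l _ (trans (Vecₚ.lookup∘tabulate _ l)
    (cong₂ _∧_ (Vecₚ.[]=⇒lookup l∈U) (dec-true (P? l) pl)))

  select⁻ : ∀ {U l} → l ∈ select U → l ∈ U × P l
  select⁻ {U} {l} l∈
    with lookup U l in eq | P? l | trans (sym (Vecₚ.lookup∘tabulate _ l)) (Vecₚ.[]=⇒lookup l∈)
  ... | true | yes pl | _ = Vecₚ.lookup⇒[]= l U eq , pl

∣p∪q∣≤∣p∣+∣q∣ : ∀ (p q : Subset m) → ∣ p ∪ q ∣ ≤ ∣ p ∣ + ∣ q ∣
∣p∪q∣≤∣p∣+∣q∣ []            []            = z≤n
∣p∪q∣≤∣p∣+∣q∣ (outside ∷ p) (outside ∷ q) = ∣p∪q∣≤∣p∣+∣q∣ p q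
∣p∪q∣≤∣p∣+∣q∣ (outside ∷ p) (inside  ∷ q) =
  ℕₚ.≤-trans (s≤s (∣p∪q∣≤∣p∣+∣q∣ p q)) (ℕₚ.≤-reflexive (sym (ℕₚ.+-suc ∣ p ∣ ∣ q ∣)))
∣p∪q∣≤∣p∣+∣q∣ (inside  ∷ p) (outside ∷ q) = s≤s (∣p∪q∣≤∣p∣+∣q∣ p q)
∣p∪q∣≤∣p∣+∣q∣ (inside  ∷ p) (inside  ∷ q) =
  s≤s (ℕₚ.≤-trans (∣p∪q∣≤∣p∣+∣q∣ p q) (ℕₚ.+-monoʳ-≤ ∣ p ∣ (ℕₚ.n≤1+n ∣ q ∣)))

⊆∪⇒∣∣≤ : ∀ {p : Subset m} q r → (∀ {l} → l ∈ p → l ∈ q ⊎ l ∈ r) → ∣ p ∣ ≤ ∣ q ∣ + ∣ r ∣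
⊆∪⇒∣∣≤ q r h = ℕₚ.≤-trans (p⊆q⇒∣p∣≤∣q∣ (x∈p∪q⁺ ∘ h)) (∣p∪q∣≤∣p∣+∣q∣ q r)

supp : Subset m → Form m → Subset m
supp U q = select (λ l → ¬? (coeff q l ℚₚ.≟ 0ℚ)) U

-- Common nonzero vertices

module _ (q : Form m) (y : Vec Bool m) where

  -- Contribution of coordinate `l` to `q` at `y`, before and after flipping `l`.
  stay turn : Fin m → ℚ
  stay l = coeff q l ℚ.* 𝟙 (lookup y l)
  turn l = coeff q l ℚ.* 𝟙 (not (lookup y l))

  rising falling : Subset m → Subset m
  rising  = select (λ l → stay l ℚₚ.<? turn l)
  falling = select (λ l → turn l ℚₚ.<? stay l)

  lookup-vertex : ∀ (z : Vec Bool m) l {b} → lookup z l ≡ b →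
    coeff q l ℚ.* lookup (vertex z) l ≡ coeff q l ℚ.* 𝟙 b
  lookup-vertex z l eq = cong (coeff q l ℚ.*_) (trans (Vecₚ.lookup-map l 𝟙 z) (cong 𝟙 eq))

  changed : ∀ {T z} → z ≗ y off T → ∀ l → lookup z l ≢ lookup y l →
    l ∈ T × lookup z l ≡ not (lookup y l)
  changed {T} agree l diff with l ∈? T
  ... | yes l∈T = l∈T , Boolₚ.¬-not diff
  ... | no  l∉T = contradiction (agree l l∉T) diff

  -- Only rising coordinates are flipped, so all changes have the same sign and nothing cancels.
  rising-< : ∀ {U z} → z ≗ y off rising U → (∃[ l ] lookup z l ≢ lookup y l) →
    evalAt q (vertex y) ℚ.< evalAt q (vertex z)
  rising-< {U} {z} agree (l , diff) =
    ℚₚ.+-monoˡ-< (const q) (dot-mono-< (coeffs q) (vertex y) (vertex z) weak l (strict l diff))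
    where
    strict : ∀ l → lookup z l ≢ lookup y l →
      coeff q l ℚ.* lookup (vertex y) l ℚ.< coeff q l ℚ.* lookup (vertex z) l
    strict l diff with l∈ , eq ← changed {z = z} agree l diff =
      subst₂ ℚ._<_ (sym (lookup-vertex y l refl)) (sym (lookup-vertex z l eq))
        (proj₂ (select⁻ (λ l → stay l ℚₚ.<? turn l) {U} l∈))
    weak : ∀ l → coeff q l ℚ.* lookup (vertex y) l ℚ.≤ coeff q l ℚ.* lookup (vertex z) l
    weak l with lookup z l Boolₚ.≟ lookup y l
    ... | yes eq   = ℚₚ.≤-reflexive (trans (lookup-vertex y l refl) (sym (lookup-vertex z l eq)))
    ... | no  diff = ℚₚ.<⇒≤ (strict l diff)

  falling-> : ∀ {U z} → z ≗ y off falling U → (∃[ l ] lookup z l ≢ lookup y l) →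
    evalAt q (vertex z) ℚ.< evalAt q (vertex y)
  falling-> {U} {z} agree (l , diff) =
    ℚₚ.+-monoˡ-< (const q) (dot-mono-< (coeffs q) (vertex z) (vertex y) weak l (strict l diff))
    where
    strict : ∀ l → lookup z l ≢ lookup y l →
      coeff q l ℚ.* lookup (vertex z) l ℚ.< coeff q l ℚ.* lookup (vertex y) l
    strict l diff with l∈ , eq ← changed {z = z} agree l diff =
      subst₂ ℚ._<_ (sym (lookup-vertex z l eq)) (sym (lookup-vertex y l refl))
        (proj₂ (select⁻ (λ l → turn l ℚₚ.<? stay l) {U} l∈))
    weak : ∀ l → coeff q l ℚ.* lookup (vertex z) l ℚ.≤ coeff q l ℚ.* lookup (vertex y) l
    weak l with lookup z l Boolₚ.≟ lookup y l
    ... | yes eq   = ℚₚ.≤-reflexive (trans (lookup-vertex z l eq) (sym (lookup-vertex y l refl)))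
    ... | no  diff = ℚₚ.<⇒≤ (strict l diff)

  stay≢turn : ∀ l → coeff q l ≢ 0ℚ → stay l ≢ turn l
  stay≢turn l a≢0 eq = *-≢0 a≢0 (𝟙-not-≢ (lookup y l)) (begin
    a ℚ.* (u ℚ.- v)      ≡⟨ solve 3 (λ a u v → a :* (u :- v) := a :* u :- a :* v) refl a u v ⟩
    a ℚ.* u ℚ.- a ℚ.* v  ≡⟨ cong (λ t → a ℚ.* u ℚ.- t) eq ⟩
    a ℚ.* u ℚ.- a ℚ.* u  ≡⟨ ℚₚ.+-inverseʳ (a ℚ.* u) ⟩
    0ℚ                   ∎)
    where
    open ≡-Reasoning
    open +-*-Solver
    a = coeff q l
    u = 𝟙 (not (lookup y l))
    v = 𝟙 (lookup y l)

  -- A nonzero coefficient makes `stay` and `turn` differ, so every flip in the support moves `q` up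
  -- or down.
  ∣supp∣≤ : ∀ U → ∣ supp U q ∣ ≤ ∣ rising U ∣ + ∣ falling U ∣
  ∣supp∣≤ U = ⊆∪⇒∣∣≤ (rising U) (falling U) split
    where
    split : ∀ {l} → l ∈ supp U q → l ∈ rising U ⊎ l ∈ falling U
    split {l} l∈ with l∈U , a≢0 ← select⁻ (λ l → ¬? (coeff q l ℚₚ.≟ 0ℚ)) {U} l∈
                 with ℚₚ.<-cmp (stay l) (turn l)
    ... | tri< lt _ _ = inj₁ (select⁺ (λ l → stay l ℚₚ.<? turn l) l∈U lt)
    ... | tri≈ _ eq _ = contradiction eq (stay≢turn l a≢0)
    ... | tri> _ _ gt = inj₂ (select⁺ (λ l → turn l ℚₚ.<? stay l) l∈U gt)

  off-select : ∀ {P : Fin m → Set} (P? : Decidable P) {U z} → z ≗ y off select P? U → z ≗ y off U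
  off-select P? agree l l∉U = agree l (l∉U ∘ proj₁ ∘ select⁻ P?)

  -- If q vanishes at y, one of the two directions has more than r coordinates; every flip
  -- inside it makes q nonzero.
  extend-nonzero : ∀ U {qs} → 2 * length qs < ∣ supp U q ∣ → All (NonzeroAt (vertex y)) qs →
    ∃[ z ] (z ≗ y off U × All (NonzeroAt (vertex z)) (q ∷ qs))
  extend-nonzero U {qs} big nz with evalAt q (vertex y) ℚₚ.≟ 0ℚ
  ... | no  qy≢0 = y , (λ _ _ → refl) , qy≢0 ∷ nz
  ... | yes qy≡0 with length qs ℕₚ.<? ∣ rising U ∣ | length qs ℕₚ.<? ∣ falling U ∣
  ...   | yes r< | _
    with z , agree , diff , nz′ ← avoid-zeros (rising U) y qs r< nz =
    z , off-select (λ l → stay l ℚₚ.<? turn l) {U} {z} agree ,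
    (λ qz≡0 → ℚₚ.<⇒≢ (rising-< {U} {z} agree diff) (trans qy≡0 (sym qz≡0))) ∷ nz′
  ...   | no _ | yes r<
    with z , agree , diff , nz′ ← avoid-zeros (falling U) y qs r< nz =
    z , off-select (λ l → turn l ℚₚ.<? stay l) {U} {z} agree ,
    (λ qz≡0 → ℚₚ.<⇒≢ (falling-> {U} {z} agree diff) (trans qz≡0 (sym qy≡0))) ∷ nz′
  ...   | no r≮ | no r≮′ = contradiction big (ℕₚ.≤⇒≯ (begin
    ∣ supp U q ∣                  ≤⟨ ∣supp∣≤ U ⟩
    ∣ rising U ∣ + ∣ falling U ∣  ≤⟨ ℕₚ.+-mono-≤ (ℕₚ.≮⇒≥ r≮) (ℕₚ.≮⇒≥ r≮′) ⟩
    length qs + length qs         ≡⟨ cong (length qs +_) (ℕₚ.+-identityʳ (length qs)) ⟨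
    2 * length qs                 ∎))
    where open ℕₚ.≤-Reasoning

-- The forms `ps` are secured already; each pending form joins them in turn. With `suc K` forms in
-- all, at most `K` are secured when one is treated, so a support above `2 * K` suffices. The extra
-- one leaves room for a new form beside `K` promises.
common-nonzero : ∀ K U (y : Vec Bool m) ps qs → length ps + length qs ≤ suc K →
  All (NonzeroAt (vertex y)) ps → All (λ q → 2 * K < ∣ supp U q ∣) qs →
  ∃[ z ] (z ≗ y off U × All (NonzeroAt (vertex z)) ps × All (NonzeroAt (vertex z)) qs)
common-nonzero K U y ps []       _     nz _            = y , (λ _ _ → refl) , nz , []
common-nonzero K U y ps (q ∷ qs) bound nz (big ∷ bigs)
  with bound′ ← subst (_≤ suc K) (ℕₚ.+-suc (length ps) (length qs)) bound
  with z , agree , nz′ ← extend-nonzero q y U {ps}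
         (ℕₚ.≤-<-trans (ℕₚ.*-monoʳ-≤ 2 (ℕₚ.≤-trans (ℕₚ.m≤m+n _ (length qs)) (ℕ.s≤s⁻¹ bound′))) big) nz
  with w , agree′ , qw≢0 ∷ nz″ , nzs ← common-nonzero K U z (q ∷ ps) qs bound′ nz′ bigs =
  w , (λ l l∉U → trans (agree′ l l∉U) (agree l l∉U)) , nz″ , qw≢0 ∷ nzs

-- Changing coordinates of a point.

p*q≢0⇒q≢0 : ∀ p {q} → p ℚ.* q ≢ 0ℚ → q ≢ 0ℚ
p*q≢0⇒q≢0 p pq≢0 q≡0 = pq≢0 (trans (cong (p ℚ.*_) q≡0) (ℚₚ.*-zeroʳ p))

evalAt-cong : ∀ (q : Form m) xs ys →
  (∀ l → coeff q l ≡ 0ℚ ⊎ lookup xs l ≡ lookup ys l) → evalAt q xs ≡ evalAt q ys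
evalAt-cong q xs ys h = cong (ℚ._+ const q) (dot-cong (coeffs q) xs ys h)

dot-update : ∀ (as xs : Vec ℚ m) j v →
  dot as (xs [ j ]≔ v) ≡ dot as xs ℚ.+ lookup as j ℚ.* (v ℚ.- lookup xs j)
dot-update (a ∷ as) (x ∷ xs) zero    v =
  solve 4 (λ a x d v → a :* v :+ d := a :* x :+ d :+ a :* (v :- x)) refl a x (dot as xs) v
  where open +-*-Solver
dot-update (a ∷ as) (x ∷ xs) (suc j) v =
  trans (cong (a ℚ.* x ℚ.+_) (dot-update as xs j v)) (sym (ℚₚ.+-assoc (a ℚ.* x) (dot as xs) _))

-- In `x_j` alone the form is affine with nonzero slope. The root `v` need not be boolean, which is
-- why allowed points have one exceptional coordinate.
solve-coordinate : ∀ (f : Form m) xs {j} → coeff f j ≢ 0ℚ → ∃[ v ] evalAt f (xs [ j ]≔ v) ≡ 0ℚ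
solve-coordinate f xs {j} a≢0 = v , (begin
  dot (coeffs f) (xs [ j ]≔ v) ℚ.+ const f
    ≡⟨ cong (ℚ._+ const f) (dot-update (coeffs f) xs j v) ⟩
  d ℚ.+ a ℚ.* (x ℚ.- i ℚ.* (d ℚ.+ b) ℚ.- x) ℚ.+ b
    ≡⟨ solve 5 (λ d a x i b → d :+ a :* (x :- i :* (d :+ b) :- x) :+ b
                           := (d :+ b) :- (a :* i) :* (d :+ b)) refl d a x i b ⟩
  d ℚ.+ b ℚ.- a ℚ.* i ℚ.* (d ℚ.+ b)
    ≡⟨ cong (λ t → d ℚ.+ b ℚ.- t ℚ.* (d ℚ.+ b)) (ℚₚ.*-inverseʳ a) ⟩
  d ℚ.+ b ℚ.- 1ℚ ℚ.* (d ℚ.+ b)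
    ≡⟨ cong (λ t → d ℚ.+ b ℚ.- t) (ℚₚ.*-identityˡ (d ℚ.+ b)) ⟩
  d ℚ.+ b ℚ.- (d ℚ.+ b)
    ≡⟨ ℚₚ.+-inverseʳ (d ℚ.+ b) ⟩
  0ℚ ∎)
  where
  open ≡-Reasoning
  open +-*-Solver
  instance
    a-nonZero : ℚ.NonZero (coeff f j)
    a-nonZero = ℚ.≢-nonZero a≢0
  a = coeff f j
  b = const f
  d = dot (coeffs f) xs
  x = lookup xs j
  i = ℚ.1/ a
  v = x ℚ.- i ℚ.* (d ℚ.+ b)

-- Supports and cardinalities.

∈supp⁺ : ∀ {U : Subset m} q {l} → l ∈ U → coeff q l ≢ 0ℚ → l ∈ supp U q
∈supp⁺ q = select⁺ (λ l → ¬? (coeff q l ℚₚ.≟ 0ℚ))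

Vanishes : Subset m → Form m → Set
Vanishes U q = ∀ l → l ∈ U → coeff q l ≡ 0ℚ

∉supp⇒≡0 : ∀ {U : Subset m} q {l} → l ∈ U → l ∉ supp U q → coeff q l ≡ 0ℚ
∉supp⇒≡0 q {l} l∈U l∉ = decidable-stable (coeff q l ℚₚ.≟ 0ℚ) (l∉ ∘ ∈supp⁺ q l∈U)

∣p∣≤∣p─q∣+∣q∣ : ∀ (p q : Subset m) → ∣ p ∣ ≤ ∣ p ─ q ∣ + ∣ q ∣
∣p∣≤∣p─q∣+∣q∣ p q = ⊆∪⇒∣∣≤ (p ─ q) q split
  where
  split : ∀ {l} → l ∈ p → l ∈ p ─ q ⊎ l ∈ q
  split {l} l∈p with l ∈? q
  ... | yes l∈q = inj₂ l∈q
  ... | no  l∉q = inj₁ (x∈p∧x∉q⇒x∈p─q l∈p l∉q)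

x∈p─q⇒x∉q : ∀ (p q : Subset m) {x} → x ∈ p ─ q → x ∉ q
x∈p─q⇒x∉q (_ ∷ p) (inside  ∷ q) (there x∈) (there x∈q) = x∈p─q⇒x∉q p q x∈ x∈q
x∈p─q⇒x∉q (_ ∷ p) (outside ∷ q) (there x∈) (there x∈q) = x∈p─q⇒x∉q p q x∈ x∈q

nonempty⇒∣∣>0 : ∀ {p : Subset m} → Nonempty p → 0 < ∣ p ∣
nonempty⇒∣∣>0 {p = p} (x , x∈p) = subst (_≤ ∣ p ∣) (∣⁅x⁆∣≡1 x)
  (p⊆q⇒∣p∣≤∣q∣ λ y∈ → subst (_∈ p) (sym (x∈⁅y⁆⇒x≡y x y∈)) x∈p)

∣∣>0⇒nonempty : ∀ {p : Subset m} → 0 < ∣ p ∣ → Nonempty p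
∣∣>0⇒nonempty {m} {p} 0<∣p∣ = decidable-stable (nonempty? p) λ empty →
  ℕₚ.<⇒≢ 0<∣p∣ (sym (trans (cong ∣_∣ (Empty-unique empty)) (∣⊥∣≡0 m)))

∣∣>1⇒another : ∀ {p : Subset m} → 1 < ∣ p ∣ → ∀ i → ∃[ j ] (j ∈ p × j ≢ i)
∣∣>1⇒another {p = p} 1<∣p∣ i with nonempty? (p ─ ⁅ i ⁆)
... | yes (j , j∈) = j , p─q⊆p p ⁅ i ⁆ j∈ , λ { refl → x∈p─q⇒x∉q p ⁅ i ⁆ j∈ (x∈⁅x⁆ i) }
... | no empty = contradiction 1<∣p∣ (ℕₚ.≤⇒≯ (subst (∣ p ∣ ≤_) (∣⁅x⁆∣≡1 i)
    (p⊆q⇒∣p∣≤∣q∣ λ {l} l∈p → decidable-stable (l ∈? ⁅ i ⁆)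
      λ l∉ → empty (l , x∈p∧x∉q⇒x∈p─q l∈p l∉))))

-- Positive size of derivations.

sizeClause>0 : ∀ {g : Form m} {E} → g List∈.∈ E → 1 ≤ sizeClause E
sizeClause>0 {E = (as , b) ∷ E} _ = ℕₚ.≤-trans (s≤s z≤n)
  (ℕₚ.≤-trans (ℕₚ.m≤n+m (bitsℚ b) (sizeCoeffs as)) (ℕₚ.m≤m+n (sizeForm (as , b)) (sizeClause E)))

-- Some leaf carries a nonempty clause, whose constant costs at least one bit. This is the bound for
-- a position without coins.
size>0 : ∀ {φ : List (Clause m)} {E} → All (λ C → ∃[ g ] g List∈.∈ C) φ → (d : Deriv φ E) → 1 ≤ size d
size>0 ne (axiom C∈φ E≈) = sizeClause>0 (_≈ₛ_.from E≈ (proj₂ (All.lookup ne C∈φ)))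
size>0 ne (boolean i E≈) = sizeClause>0 (_≈ₛ_.from E≈ (Any.here refl))
size>0 ne (resolution _ _ d e₁ e e₂ E≈) = ℕₚ.≤-trans (size>0 ne e) (ℕₚ.m≤n+m (size e) _)
size>0 ne (simplification d _ _ _) = ℕₚ.≤-trans (size>0 ne d) (ℕₚ.m≤n+m (size d) _)
size>0 ne (weakening d _) = ℕₚ.≤-trans (size>0 ne d) (ℕₚ.m≤n+m (size d) _)

-- Values of single variables and of constant forms.

dot-zeroʳ : ∀ (as : Vec ℚ m) → dot as (replicate m 0ℚ) ≡ 0ℚ
dot-zeroʳ []       = refl
dot-zeroʳ (a ∷ as) = cong₂ ℚ._+_ (ℚₚ.*-zeroʳ a) (dot-zeroʳ as)

dot-unit : ∀ (as p : Vec ℚ m) i → lookup as i ≡ 1ℚ → (∀ l → l ≢ i → lookup as l ≡ 0ℚ) →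
  dot as p ≡ lookup p i
dot-unit (a ∷ as) (x ∷ p) zero    refl zeros =
  trans (cong₂ ℚ._+_ (ℚₚ.*-identityˡ x) rest) (ℚₚ.+-identityʳ x)
  where
  rest : dot as p ≡ 0ℚ
  rest = trans (dot-cong as p (replicate _ 0ℚ) (λ l → inj₁ (zeros (suc l) λ ()))) (dot-zeroʳ as)
dot-unit (a ∷ as) (x ∷ p) (suc i) one  zeros = begin
  a ℚ.* x ℚ.+ dot as p   ≡⟨ cong (λ t → t ℚ.* x ℚ.+ dot as p) (zeros zero λ ()) ⟩
  0ℚ ℚ.* x ℚ.+ dot as p  ≡⟨ cong (ℚ._+ dot as p) (ℚₚ.*-zeroˡ x) ⟩
  0ℚ ℚ.+ dot as p        ≡⟨ ℚₚ.+-identityˡ (dot as p) ⟩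
  dot as p               ≡⟨ dot-unit as p i one (λ l l≢i → zeros (suc l) (l≢i ∘ Finₚ.suc-injective)) ⟩
  lookup p i             ∎
  where open ≡-Reasoning

-- The indicator inside varForm cannot be named here; unification recovers it as f.
lookup-tabulate : ∀ {f : Fin m → ℚ} {v} {l x} → v ≡ tabulate f → f l ≡ x → lookup v l ≡ x
lookup-tabulate {f = f} {l = l} refl eq = trans (Vecₚ.lookup∘tabulate f l) eq

coeff-varForm-self : ∀ (i : Fin m) b → coeff (varForm i b) i ≡ 1ℚ
coeff-varForm-self i b with i Finₚ.≟ i | lookup-tabulate {l = i} (refl {x = coeffs (varForm i b)})
... | yes _  | k = k refl
... | no i≢i | _ = contradiction refl i≢i

coeff-varForm-other : ∀ (i : Fin m) b l → l ≢ i → coeff (varForm i b) l ≡ 0ℚ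
coeff-varForm-other i b l l≢i with i Finₚ.≟ l | lookup-tabulate {l = l} (refl {x = coeffs (varForm i b)})
... | yes i≡l | _ = contradiction (sym i≡l) l≢i
... | no _    | k = k refl

evalAt-varForm : ∀ (i : Fin m) b p → evalAt (varForm i b) p ≡ lookup p i ℚ.+ b
evalAt-varForm i b p = cong (ℚ._+ b)
  (dot-unit (coeffs (varForm i b)) p i (coeff-varForm-self i b) (coeff-varForm-other i b))

dot-0 : ∀ (p : Vec ℚ m) → dot (replicate m 0ℚ) p ≡ 0ℚ
dot-0 []      = refl
dot-0 (x ∷ p) = cong₂ ℚ._+_ (ℚₚ.*-zeroˡ x) (dot-0 p)

evalAt-const : ∀ {g : Form m} → NonzeroConst g → ∀ p → NonzeroAt p g
evalAt-const {g = _ , b} (refl , b≢0) p eq =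
  b≢0 (trans (sym (trans (cong (ℚ._+ b) (dot-0 p)) (ℚₚ.+-identityˡ b))) eq)

-- Delayer's positions and strategy.

module Game {m} (f₀ : Form m) (K : ℕ) where

  -- On the hyperplane f₀ = 0 this form is a multiple of h, and it does not mention x_j.
  reduce : Form m → Fin m → Form m
  reduce h j = lincomb (coeff f₀ j) h (ℚ.- coeff h j) f₀

  coeff-reduce : ∀ h j → coeff (reduce h j) j ≡ 0ℚ
  coeff-reduce h j = begin
    coeff (reduce h j) j     ≡⟨ Vecₚ.lookup-zipWith _ j (coeffs h) (coeffs f₀) ⟩
    a ℚ.* u ℚ.+ ℚ.- u ℚ.* a  ≡⟨ solve 2 (λ a u → a :* u :+ :- u :* a := con 0ℚ) refl a u ⟩
    0ℚ                       ∎
    where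
    open ≡-Reasoning
    open +-*-Solver
    a = coeff f₀ j
    u = coeff h j

  evalAt-reduce : ∀ h j {p} → evalAt f₀ p ≡ 0ℚ → evalAt (reduce h j) p ≡ coeff f₀ j ℚ.* evalAt h p
  evalAt-reduce h j {p} root = begin
    evalAt (reduce h j) p        ≡⟨ evalAt-lincomb a h (ℚ.- u) f₀ p ⟩
    v ℚ.+ ℚ.- u ℚ.* evalAt f₀ p  ≡⟨ cong (λ t → v ℚ.+ ℚ.- u ℚ.* t) root ⟩
    v ℚ.+ ℚ.- u ℚ.* 0ℚ           ≡⟨ cong (v ℚ.+_) (ℚₚ.*-zeroʳ (ℚ.- u)) ⟩
    v ℚ.+ 0ℚ                     ≡⟨ ℚₚ.+-identityʳ v ⟩
    v                            ∎
    where
    open ≡-Reasoning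
    a = coeff f₀ j
    u = coeff h j
    v = a ℚ.* evalAt h p

  reduce-≢0 : ∀ h j {p} → evalAt f₀ p ≡ 0ℚ → NonzeroAt p (reduce h j) → NonzeroAt p h
  reduce-≢0 h j root nz =
    p*q≢0⇒q≢0 (coeff f₀ j) (subst (_≢ 0ℚ) (evalAt-reduce h j root) nz)

  -- All `j` are required, because a position leaves open which coordinate of an allowed point is
  -- the non-boolean one.
  Large : Subset m → Form m → Set
  Large U h = ∀ j → j ∈ U → 2 * K < ∣ supp U (reduce h j) ∣

  Small : Subset m → Form m → Fin m → Set
  Small U h j = j ∈ U × ∣ supp U (reduce h j) ∣ ≤ 2 * K

  large⊎small : ∀ U h → Large U h ⊎ ∃[ j ] Small U h j
  large⊎small U h
    with Finₚ.any? (λ j → (j ∈? U) ×-dec (∣ supp U (reduce h j) ∣ ℕₚ.≤? 2 * K))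
  ... | yes small = inj₂ small
  ... | no ¬small = inj₁ λ j j∈U → ℕₚ.≰⇒> λ le → ¬small (j , j∈U , le)

  extract-small : ∀ U H →
    All (Large U) H ⊎ ∃[ h ] ∃[ j ] ∃[ H′ ] (H ↭ h ∷ H′ × Small U h j)
  extract-small U []      = inj₁ []
  extract-small U (h ∷ H) with large⊎small U h
  ... | inj₂ (j , small) = inj₂ (h , j , H , ↭-refl , small)
  ... | inj₁ large with extract-small U H
  ...   | inj₁ larges = inj₁ (large ∷ larges)
  ...   | inj₂ (g , j , H′ , perm , small) =
    inj₂ (g , j , h ∷ H′ , ↭-trans (prep h perm) (swap h g ↭-refl) , small)

  -- Outcome of repeatedly taking the support of a small form out of `U`, which can make further
  -- forms small. Each removed form is paired with the `j` witnessing smallness; `j` lies in the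
  -- original `U`, so largeness of the form over a set containing `U` can later be applied to it.
  record Closure (U : Subset m) (H : List (Form m)) : Set where
    field
      U′      : Subset m
      H′      : List (Form m)
      removed : List (Form m × Fin m)
      U′⊆U    : U′ ⊆ U
      perm    : H ↭ map proj₁ removed ++ H′
      large   : All (Large U′) H′
      cost    : ∣ U ∣ ≤ ∣ U′ ∣ + 2 * K * length removed
      reduced : All (λ (h , j) → j ∈ U × Vanishes U′ (reduce h j)) removed

  shrink-cost : ∀ U {h j} → Small U h j →
    ∣ U ∣ ≤ ∣ U ─ supp U (reduce h j) ∣ + 2 * K
  shrink-cost U (_ , small) =
    ℕₚ.≤-trans (∣p∣≤∣p─q∣+∣q∣ U _) (ℕₚ.+-monoʳ-≤ _ small)

  vanishes-shrink : ∀ U h j → Vanishes (U ─ supp U (reduce h j)) (reduce h j)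
  vanishes-shrink U h j l l∈ = ∉supp⇒≡0 (reduce h j) (p─q⊆p U _ l∈) (x∈p─q⇒x∉q U _ l∈)

  -- Each round moves one form from `H` to `removed`, hence recursion on the length. The vanishing
  -- obtained for that form persists as `U` shrinks further.
  close : ∀ n U H → length H ≡ n → Closure U H
  close n U H len with extract-small U H
  close n U H len | inj₁ larges = record
    { U′ = U ; H′ = H ; removed = [] ; U′⊆U = λ l∈ → l∈ ; perm = ↭-refl ; large = larges
    ; cost = ℕₚ.m≤m+n ∣ U ∣ _ ; reduced = [] }
  close zero U [] len | inj₂ (h , j , H₁ , perm₁ , small) = contradiction (↭-length perm₁) λ ()
  close (suc n) U H len | inj₂ (h , j , H₁ , perm₁ , small@(j∈U , _)) = record
    { U′ = C.U′ ; H′ = C.H′ ; removed = (h , j) ∷ C.removed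
    ; U′⊆U = p─q⊆p U _ ∘ C.U′⊆U
    ; perm = ↭-trans perm₁ (prep h C.perm)
    ; large = C.large
    ; cost = begin
        ∣ U ∣                                  ≤⟨ shrink-cost U {h} {j} small ⟩
        ∣ U₁ ∣ + s                             ≤⟨ ℕₚ.+-monoˡ-≤ s C.cost ⟩
        ∣ C.U′ ∣ + s * length C.removed + s    ≡⟨ rearrange ∣ C.U′ ∣ s (length C.removed) ⟩
        ∣ C.U′ ∣ + s * suc (length C.removed)  ∎
    ; reduced = (j∈U , λ l l∈ → vanishes-shrink U h j l (C.U′⊆U l∈)) ∷
                All.map (λ (i∈ , v) → p─q⊆p U _ i∈ , v) C.reduced }
    where
    open ℕₚ.≤-Reasoning
    s = 2 * K
    U₁ = U ─ supp U (reduce h j)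
    module C = Closure (close n U₁ H₁ (ℕₚ.suc-injective (trans (sym (↭-length perm₁)) len)))
    rearrange : ∀ u s r → u + s * r + s ≡ u + s * suc r
    rearrange = solve-∀

  -- Delayer's position with b coins still to be earned: the variables outside U are set
  -- according to ρ (whose values on U are irrelevant), and H collects those disequalities
  -- promised to Prover that are not yet settled by ρ.
  record State (b : ℕ) : Set where
    field
      U      : Subset m
      ρ      : Vec Bool m
      H      : List (Form m)
      active : ∀ {l} → l ∈ U → coeff f₀ l ≢ 0ℚ
      large  : All (Large U) H
      -- Every coin may add one promise, so there are never more than `K`. Settling a form fixes at
      -- most `2 * K` variables, and `wide` is the budget for promises made and coins to come; the
      -- final 2 keeps a second coordinate available at the end.
      few    : b + length H ≤ K
      wide   : 2 * K * (2 * b + length H) + 2 ≤ ∣ U ∣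
  open State

  -- Boolean except possibly in coordinate j.
  record Allowed {b} (σ : State b) (j : Fin m) (p : Vec ℚ m) : Set where
    field
      j∈U     : j ∈ U σ
      fixed   : ∀ l → l ∉ U σ → lookup p l ≡ 𝟙 (lookup (ρ σ) l)
      zeroOne : ∀ l → l ≢ j → ∃[ x ] lookup p l ≡ 𝟙 x
      root    : evalAt f₀ p ≡ 0ℚ
      nonzero : All (NonzeroAt p) (H σ)

  -- The reduced forms do not mention `x_j`, so moving coordinate `j` keeps their values. On the
  -- hyperplane their being nonzero passes back to the promised forms.
  allowed-extension : ∀ {b} (σ : State b) {j} → j ∈ U σ → ∀ z → z ≗ ρ σ off U σ →
    All (λ h → NonzeroAt (vertex z) (reduce h j)) (H σ) →
    ∀ v → evalAt f₀ (vertex z [ j ]≔ v) ≡ 0ℚ → Allowed σ j (vertex z [ j ]≔ v)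
  allowed-extension σ {j} j∈U z agree nz v root = record
    { j∈U = j∈U
    ; fixed = λ l l∉U → trans (other l (λ { refl → l∉U j∈U })) (cong 𝟙 (agree l l∉U))
    ; zeroOne = λ l l≢j → lookup z l , other l l≢j
    ; root = root
    ; nonzero = All.map (λ {h} → unreduce h) nz }
    where
    p = vertex z [ j ]≔ v
    other : ∀ l → l ≢ j → lookup p l ≡ 𝟙 (lookup z l)
    other l l≢j = trans (Vecₚ.lookup∘updateAt′ l j l≢j (vertex z)) (Vecₚ.lookup-map l 𝟙 z)
    unreduce : ∀ h → NonzeroAt (vertex z) (reduce h j) → NonzeroAt p h
    unreduce h nz = reduce-≢0 h j root (subst (_≢ 0ℚ) (evalAt-cong (reduce h j) (vertex z) p same) nz)
      where
      same : ∀ l → coeff (reduce h j) l ≡ 0ℚ ⊎ lookup (vertex z) l ≡ lookup p l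
      same l with l Finₚ.≟ j
      ... | yes refl = inj₁ (coeff-reduce h j)
      ... | no  l≢j  = inj₂ (sym (Vecₚ.lookup∘updateAt′ l j l≢j (vertex z)))

  -- No position is contradictory: at most `K` reduced promises, all of support above `2 * K`, have
  -- a common nonzero vertex, and `x_j` is then solved for.
  allowed-point : ∀ {b} (σ : State b) {j} → j ∈ U σ → ∃[ p ] Allowed σ j p
  allowed-point {b} σ {j} j∈U =
    let z , agree , _ , nz = common-nonzero K (U σ) (ρ σ) [] (map (λ h → reduce h j) (H σ))
                               (ℕₚ.≤-trans (ℕₚ.≤-reflexive (Listₚ.length-map _ (H σ)))
                                 (ℕₚ.m≤n⇒m≤1+n (ℕₚ.≤-trans (ℕₚ.m≤n+m _ b) (few σ)))) []
                               (Allₚ.map⁺ (All.map (λ big → big j j∈U) (large σ)))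
        v , root = solve-coordinate f₀ (vertex z) (active σ j∈U)
    in vertex z [ j ]≔ v , allowed-extension σ j∈U z agree (Allₚ.map⁻ nz) v root

  evalAt-fixed : ∀ {V} (q : Form m) → Vanishes V q → ∀ y p →
    (∀ l → l ∉ V → lookup p l ≡ 𝟙 (lookup y l)) → evalAt q p ≡ evalAt q (vertex y)
  evalAt-fixed {V} q vanishes y p fixed = evalAt-cong q p (vertex y) same
    where
    same : ∀ l → coeff q l ≡ 0ℚ ⊎ lookup p l ≡ lookup (vertex y) l
    same l with l ∈? V
    ... | yes l∈V = inj₁ (vanishes l l∈V)
    ... | no  l∉V = inj₂ (trans (fixed l l∉V) (sym (Vecₚ.lookup-map l 𝟙 y)))

  -- Making a new promise.

  ZeroOn NonzeroOn : ∀ {b} → State b → Form m → Set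
  ZeroOn    σ g = ∀ {j p} → Allowed σ j p → evalAt g p ≡ 0ℚ
  NonzeroOn σ g = ∀ {j p} → Allowed σ j p → NonzeroAt p g

  Free : ∀ {b} → State b → Form m → Set
  Free σ g = ∀ {j} → j ∈ U σ → Nonempty (supp (U σ) (reduce g j))

  -- If some `reduce g j` has no variable left in `U`, its value is the same at all allowed points,
  -- whatever their non-boolean coordinate, and can be read off at `ρ`.
  classify : ∀ {b} (σ : State b) g → NonzeroOn σ g ⊎ ZeroOn σ g ⊎ Free σ g
  classify σ g with Finₚ.any? (λ j → (j ∈? U σ) ×-dec ¬? (nonempty? (supp (U σ) (reduce g j))))
  ... | no ¬const = inj₂ (inj₂ λ {j} j∈U →
    decidable-stable (nonempty? _) λ empty → ¬const (j , j∈U , empty))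
  ... | yes (j , j∈U , empty) = byValue (evalAt (reduce g j) (vertex (ρ σ)) ℚₚ.≟ 0ℚ)
    where
    constant : ∀ {i p} → Allowed σ i p → evalAt (reduce g j) p ≡ evalAt (reduce g j) (vertex (ρ σ))
    constant {_} {p} al = evalAt-fixed (reduce g j)
      (λ _ l∈U → ∉supp⇒≡0 (reduce g j) l∈U (λ l∈ → empty (_ , l∈))) (ρ σ) p (Allowed.fixed al)
    byValue : Dec (evalAt (reduce g j) (vertex (ρ σ)) ≡ 0ℚ) → NonzeroOn σ g ⊎ ZeroOn σ g ⊎ Free σ g
    byValue (yes v≡0) = inj₂ (inj₁ λ al → p*q≡0⇒q≡0 (active σ j∈U)
      (trans (sym (evalAt-reduce g j (Allowed.root al))) (trans (constant al) v≡0)))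
    byValue (no  v≢0) = inj₁ λ al → reduce-≢0 g j (Allowed.root al)
      (λ eq → v≢0 (trans (sym (constant al)) eq))

  Successor : ∀ {b} → State (suc b) → Form m → Set
  Successor {b} σ g = ∃[ τ ] (∀ {j p} → Allowed {b} τ j p → Allowed σ j p × NonzeroAt p g)

  -- Nothing is fixed: the coin releases two units of the budget and the new promise takes one.
  promise-large : ∀ {b} (σ : State (suc b)) g → Large (U σ) g → Successor σ g
  promise-large {b} σ g big = record
    { U = U σ ; ρ = ρ σ ; H = g ∷ H σ ; active = active σ ; large = big ∷ large σ
    ; few = subst (_≤ K) (sym (ℕₚ.+-suc b (length (H σ)))) (few σ)
    ; wide = ℕₚ.≤-trans (ℕₚ.+-monoˡ-≤ 2 (ℕₚ.*-monoʳ-≤ (2 * K) (less b (length (H σ))))) (wide σ) } ,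
    λ al → let open Allowed al in
      record { j∈U = j∈U ; fixed = fixed ; zeroOne = zeroOne ; root = root
             ; nonzero = All.tail nonzero } ,
      All.head nonzero
    where
    less : ∀ b h → 2 * b + suc h ≤ 2 * suc b + h
    less b h = ℕₚ.≤-trans (ℕₚ.n≤1+n _) (ℕₚ.≤-reflexive (eq b h))
      where
      eq : ∀ b h → suc (2 * b + suc h) ≡ 2 * suc b + h
      eq = solve-∀

  -- Fixing the support of g may make forms of H small, so these are settled along with g.
  module Settle {b} (σ : State (suc b)) (g : Form m) {j} (small : Small (U σ) g j) where
    j∈U = proj₁ small
    U₁ = U σ ─ supp (U σ) (reduce g j)
    U₁⊆U : U₁ ⊆ U σ
    U₁⊆U = p─q⊆p (U σ) _

    module C = Closure (close (length (H σ)) U₁ (H σ) refl)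

    settled : List (Form m)
    settled = map (uncurry reduce) C.removed

    length-H : length (H σ) ≡ length C.removed + length C.H′
    length-H = begin
      length (H σ)                                ≡⟨ ↭-length C.perm ⟩
      length (map proj₁ C.removed ++ C.H′)        ≡⟨ Listₚ.length-++ (map proj₁ C.removed) ⟩
      length (map proj₁ C.removed) + length C.H′  ≡⟨ cong (_+ length C.H′) (Listₚ.length-map proj₁ C.removed) ⟩
      length C.removed + length C.H′              ∎
      where open ≡-Reasoning

    few-settled : 1 + length settled ≤ suc K
    few-settled = s≤s (begin
      length settled                  ≡⟨ Listₚ.length-map _ C.removed ⟩
      length C.removed                ≤⟨ ℕₚ.m≤m+n _ (length C.H′) ⟩
      length C.removed + length C.H′  ≡⟨ length-H ⟨
      length (H σ)                    ≤⟨ ℕₚ.m≤n+m _ (suc b) ⟩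
      suc b + length (H σ)            ≤⟨ few σ ⟩
      K                               ∎)
      where open ℕₚ.≤-Reasoning

    -- These forms became small only after `U` shrank. Over `U σ`, where the values are still to be
    -- chosen, they are large.
    settled-large : All (λ q → 2 * K < ∣ supp (U σ) q ∣) settled
    settled-large = Allₚ.map⁺ (All.zipWith (λ (big , i∈U₁ , _) → big _ (U₁⊆U i∈U₁))
      (Allₚ.map⁻ (Allₚ.++⁻ˡ (map proj₁ C.removed) (All-resp-↭ C.perm (large σ))) , C.reduced))

    assignment : Free σ g → ∃[ z ] (z ≗ ρ σ off U σ × NonzeroAt (vertex z) (reduce g j) ×
                                    All (NonzeroAt (vertex z)) settled)
    assignment free =
      -- `g` comes first: with nothing to preserve, any nonempty support suffices. The large forms
      -- then follow without disturbing it.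
      let y , agree₁ , nzᵍ =
            extend-nonzero (reduce g j) (ρ σ) (U σ) {[]} (nonempty⇒∣∣>0 (free j∈U)) []
          z , agree₂ , nzᵍ′ , nzs =
            common-nonzero K (U σ) y (reduce g j ∷ []) settled few-settled nzᵍ settled-large
      in z , (λ l l∉U → trans (agree₂ l l∉U) (agree₁ l l∉U)) , All.head nzᵍ′ , nzs

    next : Vec Bool m → State b
    next z = record
      { U = C.U′ ; ρ = z ; H = C.H′ ; active = active σ ∘ U₁⊆U ∘ C.U′⊆U ; large = C.large
      ; few = begin
          b + length C.H′                           ≤⟨ ℕₚ.+-mono-≤ (ℕₚ.n≤1+n b) (ℕₚ.m≤n+m _ (length C.removed)) ⟩
          suc b + (length C.removed + length C.H′)  ≡⟨ cong (suc b +_) length-H ⟨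
          suc b + length (H σ)                      ≤⟨ few σ ⟩
          K                                         ∎
      -- The coin releases `2 * s` and the settled promises `s * r`; at most `s` variables are fixed
      -- for `g` and `s * r` for those promises.
      ; wide = ℕₚ.+-cancelʳ-≤ (s * length C.removed + s) _ _ (begin
          s * (2 * b + h) + 2 + (s * r + s)      ≤⟨ ℕₚ.m≤m+n _ s ⟩
          s * (2 * b + h) + 2 + (s * r + s) + s  ≡⟨ rearrange s b h r ⟩
          s * (2 * suc b + (r + h)) + 2          ≡⟨ cong (λ t → s * (2 * suc b + t) + 2) length-H ⟨
          s * (2 * suc b + length (H σ)) + 2     ≤⟨ wide σ ⟩
          ∣ U σ ∣                                ≤⟨ shrink-cost (U σ) {g} {j} small ⟩
          ∣ U₁ ∣ + s                             ≤⟨ ℕₚ.+-monoˡ-≤ s C.cost ⟩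
          ∣ C.U′ ∣ + s * r + s                   ≡⟨ ℕₚ.+-assoc ∣ C.U′ ∣ (s * r) s ⟩
          ∣ C.U′ ∣ + (s * r + s)                 ∎) }
      where
      open ℕₚ.≤-Reasoning
      s = 2 * K
      r = length C.removed
      h = length C.H′
      rearrange : ∀ s b h r → s * (2 * b + h) + 2 + (s * r + s) + s
                            ≡ s * (2 * suc b + (r + h)) + 2
      rearrange = solve-∀

    -- The settled reduced forms depend only on fixed variables, so their values at `z` are their
    -- values at every allowed point.
    sound : ∀ {z} → z ≗ ρ σ off U σ → NonzeroAt (vertex z) (reduce g j) →
      All (NonzeroAt (vertex z)) settled →
      ∀ {i p} → Allowed (next z) i p → Allowed σ i p × NonzeroAt p g
    sound {z} agree gz≢0 nzs {i} {p} al = record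
      { j∈U = U′⊆U A.j∈U
      ; fixed = λ l l∉U → trans (A.fixed l (l∉U ∘ U′⊆U)) (cong 𝟙 (agree l l∉U))
      ; zeroOne = A.zeroOne
      ; root = A.root
      ; nonzero = All-resp-↭ (↭-sym C.perm) (Allₚ.++⁺ (Allₚ.map⁺
          (All.zipWith (λ { {h , i} (nz , _ , v) → unfix h i v nz }) (Allₚ.map⁻ nzs , C.reduced)))
          A.nonzero)
      } , unfix g j (λ l l∈ → vanishes-shrink (U σ) g j l (C.U′⊆U l∈)) gz≢0
      where
      module A = Allowed al
      U′⊆U : C.U′ ⊆ U σ
      U′⊆U = U₁⊆U ∘ C.U′⊆U
      unfix : ∀ h i → Vanishes C.U′ (reduce h i) → NonzeroAt (vertex z) (reduce h i) → NonzeroAt p h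
      unfix h i v nz = reduce-≢0 h i A.root
        (subst (_≢ 0ℚ) (sym (evalAt-fixed (reduce h i) v z p A.fixed)) nz)

  promise : ∀ {b} (σ : State (suc b)) g → Free σ g → Successor σ g
  promise σ g free with large⊎small (U σ) g
  ... | inj₁ big         = promise-large σ g big
  ... | inj₂ (j , small) =
    let z , agree , gz≢0 , nzs = Settle.assignment σ g small free
    in Settle.next σ g small z , Settle.sound σ g small agree gz≢0 nzs

  -- Tracing the game through a refutation

  Falsified : ∀ {b} → State b → Clause m → Set
  Falsified σ E = ∀ {g} → g List∈.∈ E → NonzeroOn σ g

  falsified-∷ʳ : ∀ {b} (σ : State b) C {g P} → P ≈ₛ (C ++ [ g ]) → Falsified σ C → NonzeroOn σ g →
    Falsified σ P
  falsified-∷ʳ σ C P≈ fC ng g∈ with ∈-++⁻ C (_≈ₛ_.to P≈ g∈)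
  ... | inj₁ g∈C             = fC g∈C
  ... | inj₂ (Any.here refl) = ng

  successor-falsified : ∀ {b} {σ : State (suc b)} {g C P} (s : Successor σ g) → P ≈ₛ (C ++ [ g ]) →
    Falsified σ C → Falsified (proj₁ s) P
  successor-falsified {C = C} (τ , sound) P≈ fC =
    falsified-∷ʳ τ C P≈ (λ g∈C al → fC g∈C (proj₁ (sound al))) (λ al → proj₂ (sound al))

  wide-U : ∀ {b} (σ : State b) → 2 ≤ ∣ U σ ∣
  wide-U {b} σ = ℕₚ.≤-trans (ℕₚ.m≤n+m 2 (2 * K * (2 * b + length (H σ)))) (wide σ)

  point : ∀ {b} (σ : State b) i → ∃[ j ] ∃[ p ] (j ≢ i × Allowed σ j p)
  point σ i =
    let j , j∈U , j≢i = ∣∣>1⇒another (wide-U σ) i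
        p , al = allowed-point σ j∈U
    in j , p , j≢i , al

  -- At an allowed point whose exceptional coordinate is not `i`, the variable `x_i` is 0 or 1 and
  -- the axiom holds.
  allowed-boolean : ∀ {b} (σ : State b) {E} i →
    E ≈ₛ (varForm i 0ℚ ∷ varForm i (ℚ.- 1ℚ) ∷ []) → ¬ Falsified σ E
  allowed-boolean σ i E≈ fE = contra (point σ i)
    where
    contra : ¬ (∃[ j ] ∃[ p ] (j ≢ i × Allowed σ j p))
    contra (j , p , j≢i , al) with Allowed.zeroOne al i (λ i≡j → j≢i (sym i≡j))
    ... | false , p≡0 = fE (_≈ₛ_.from E≈ (Any.here refl)) al
      (trans (evalAt-varForm i 0ℚ p) (cong (ℚ._+ 0ℚ) p≡0))
    ... | true  , p≡1 = fE (_≈ₛ_.from E≈ (Any.there (Any.here refl))) al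
      (trans (evalAt-varForm i (ℚ.- 1ℚ) p) (cong (ℚ._+ ℚ.- 1ℚ) p≡1))

  lincomb-zeroˡ : ∀ {b} (σ : State b) α f β g →
    NonzeroOn σ (lincomb α f β g) → ZeroOn σ f → NonzeroOn σ g
  lincomb-zeroˡ σ α f β g nz z {p = p} al g≡0 = nz al (trans (evalAt-lincomb α f β g p)
    (cong₂ ℚ._+_ (trans (cong (α ℚ.*_) (z al)) (ℚₚ.*-zeroʳ α))
           (trans (cong (β ℚ.*_) g≡0) (ℚₚ.*-zeroʳ β))))

  lincomb-zeroʳ : ∀ {b} (σ : State b) α f β g →
    NonzeroOn σ (lincomb α f β g) → ZeroOn σ g → NonzeroOn σ f
  lincomb-zeroʳ σ α f β g nz z {p = p} al f≡0 = nz al (trans (evalAt-lincomb α f β g p)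
    (cong₂ ℚ._+_ (trans (cong (α ℚ.*_) f≡0) (ℚₚ.*-zeroʳ α))
           (trans (cong (β ℚ.*_) (z al)) (ℚₚ.*-zeroʳ β))))

  -- Induction on the derivation, descending to premises falsified at all allowed points. A leaf
  -- reached with coins left is contradictory: allowed points satisfy `f₀ = 0`, and each boolean
  -- axiom holds at some of them.
  size-lower-bound : ∀ {b E} (σ : State b) (d : Deriv ((f₀ ∷ []) ∷ []) E) →
    Falsified σ E → 2 ^ b ≤ size d
  size-lower-bound {zero} σ d fE = size>0 ((_ , Any.here refl) ∷ []) d
  size-lower-bound {suc b} σ (axiom (Any.here refl) E≈) fE =
    let j , j∈U = ∣∣>0⇒nonempty (ℕₚ.<-trans ℕ.z<s (wide-U σ))
        p , al = allowed-point σ j∈U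
    in contradiction (Allowed.root al) (fE (_≈ₛ_.from E≈ (Any.here refl)) al)
  size-lower-bound {suc b} σ (boolean i E≈) fE = contradiction (λ {g} → fE {g}) (allowed-boolean σ i E≈)
  size-lower-bound {suc b} {E} σ (resolution {C = C} {D} {f} {g} α β d P≈ e Q≈ E≈) fE =
    split (classify σ f) (classify σ g)
    where
    fC : Falsified σ C
    fC g∈C = fE (_≈ₛ_.from E≈ (∈-++⁺ˡ g∈C))
    fD : Falsified σ D
    fD g∈D = fE (_≈ₛ_.from E≈ (∈-++⁺ʳ C (∈-++⁺ˡ g∈D)))
    nz : NonzeroOn σ (lincomb α f β g)
    nz = fE (_≈ₛ_.from E≈ (∈-++⁺ʳ C (∈-++⁺ʳ D (Any.here refl))))
    left : NonzeroOn σ f → 2 ^ suc b ≤ sizeClause E + size d + size e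
    left nf = ℕₚ.≤-trans (size-lower-bound σ d (falsified-∷ʳ σ C P≈ fC nf))
      (ℕₚ.≤-trans (ℕₚ.m≤n+m (size d) (sizeClause E)) (ℕₚ.m≤m+n _ (size e)))
    right : NonzeroOn σ g → 2 ^ suc b ≤ sizeClause E + size d + size e
    right ng = ℕₚ.≤-trans (size-lower-bound σ e (falsified-∷ʳ σ D Q≈ fD ng)) (ℕₚ.m≤n+m (size e) _)
    split : NonzeroOn σ f ⊎ ZeroOn σ f ⊎ Free σ f →
            NonzeroOn σ g ⊎ ZeroOn σ g ⊎ Free σ g →
            2 ^ suc b ≤ sizeClause E + size d + size e
    split (inj₁ nf)        _                = left nf
    -- Where one form vanishes, a nonzero combination forces the other to be nonzero, so the descent
    -- costs no coin.
    split (inj₂ (inj₁ zf)) _                = right (lincomb-zeroˡ σ α f β g nz zf)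
    split (inj₂ (inj₂ _))  (inj₁ ng)        = right ng
    split (inj₂ (inj₂ _))  (inj₂ (inj₁ zg)) = left (lincomb-zeroʳ σ α f β g nz zg)
    -- Neither form is decided: `f` is promised nonzero on the left and `g` on the right, one coin
    -- on each side. Tree-likeness makes the two sizes add up.
    split (inj₂ (inj₂ ff)) (inj₂ (inj₂ fg)) = begin
      2 ^ b + (2 ^ b + 0)  ≡⟨ cong (2 ^ b +_) (ℕₚ.+-identityʳ (2 ^ b)) ⟩
      2 ^ b + 2 ^ b        ≤⟨ ℕₚ.+-mono-≤
        (size-lower-bound (proj₁ sf) d (successor-falsified {σ = σ} sf P≈ fC))
        (size-lower-bound (proj₁ sg) e (successor-falsified {σ = σ} sg Q≈ fD)) ⟩
      size d + size e                 ≤⟨ ℕₚ.+-monoˡ-≤ (size e) (ℕₚ.m≤n+m (size d) (sizeClause E)) ⟩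
      sizeClause E + size d + size e  ∎
      where
      open ℕₚ.≤-Reasoning
      sf = promise σ f ff
      sg = promise σ g fg
  size-lower-bound {suc b} σ (simplification {C = C} d P≈ const≢0 E≈) fE =
    ℕₚ.≤-trans (size-lower-bound σ d (falsified-∷ʳ σ C P≈ (λ g∈C → fE (_≈ₛ_.from E≈ g∈C))
                 (λ {_} {p} _ → evalAt-const const≢0 p)))
               (ℕₚ.m≤n+m (size d) _)
  size-lower-bound {suc b} σ (weakening d E≈) fE =
    ℕₚ.≤-trans (size-lower-bound σ d (λ g∈P → fE (_≈ₛ_.from E≈ (∈-++⁺ˡ g∈P)))) (ℕₚ.m≤n+m (size d) _)

-- Choice of parameters.

countNZ≤∣supp∣ : ∀ (as : Vec ℚ m) b → countNZ as ≤ ∣ supp ⊤ (as , b) ∣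
countNZ≤∣supp∣ []       b = z≤n
countNZ≤∣supp∣ (a ∷ as) b with a ℚₚ.≟ 0ℚ
... | yes _ = countNZ≤∣supp∣ as b
... | no  _ = s≤s (countNZ≤∣supp∣ as b)

initial : ∀ {m} (f : Form m) K → 2 * K * (2 * K + 0) + 2 ≤ nvars f → Game.State f K K
initial {m} f K enough = record
  -- Variables absent from `f` are set to 0 at once, since only those with a nonzero coefficient can
  -- be solved for.
  { U = supp ⊤ f ; ρ = replicate m false ; H = []
  ; active = λ l∈ → proj₂ (select⁻ (λ l → ¬? (coeff f l ℚₚ.≟ 0ℚ)) {⊤} l∈)
  ; large = [] ; few = ℕₚ.≤-reflexive (ℕₚ.+-identityʳ K)
  ; wide = ℕₚ.≤-trans enough (countNZ≤∣supp∣ (coeffs f) (const f)) }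

-- With `K` for `suc k`, induction on `n` raises `K` as soon as the next value satisfies
-- `4K² + 2 ≤ n`. The start 6 is this bound at `K = 1`, and 17 comes from `4(K + 1)² + 1 ≤ 17K²`, an
-- equality at `K = 1`.
square-approximation : ∀ n → 6 ≤ n →
  ∃[ k ] (2 * suc k * (2 * suc k + 0) + 2 ≤ n × n ≤ 17 * (suc k * suc k))
square-approximation n 6≤n = go (ℕₚ.≤⇒≤′ 6≤n)
  where
  lower : ℕ → ℕ
  lower k = 2 * k * (2 * k + 0) + 2
  go : ∀ {n} → 6 ℕ.≤′ n → ∃[ k ] (lower (suc k) ≤ n × n ≤ 17 * (suc k * suc k))
  go ℕ.≤′-refl = 0 , ℕₚ.≤-refl , ℕₚ.m≤m+n 6 11
  go {suc n} (ℕ.≤′-step 6≤n) with k , lo , hi ← go 6≤n with lower (2 + k) ℕₚ.≤? suc n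
  ... | yes lo′ = suc k , lo′ , (begin
    suc n                                       ≤⟨ s≤s hi ⟩
    suc (17 * (suc k * suc k))                  ≤⟨ ℕₚ.m≤m+n _ (34 * k + 50) ⟩
    suc (17 * (suc k * suc k)) + (34 * k + 50)  ≡⟨ eq k ⟩
    17 * ((2 + k) * (2 + k))                    ∎)
    where
    open ℕₚ.≤-Reasoning
    eq : ∀ k → suc (17 * (suc k * suc k)) + (34 * k + 50) ≡ 17 * ((2 + k) * (2 + k))
    eq = solve-∀
  ... | no ¬lo′ = k , ℕₚ.m≤n⇒m≤1+n lo , ℕ.s≤s⁻¹ (begin
    suc (suc n)                              ≤⟨ ℕₚ.≰⇒> ¬lo′ ⟩
    lower (2 + k)                            ≤⟨ ℕₚ.m≤m+n _ (13 * (k * k) + 18 * k) ⟩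
    lower (2 + k) + (13 * (k * k) + 18 * k)  ≡⟨ eq k ⟩
    suc (17 * (suc k * suc k))               ∎)
    where
    open ℕₚ.≤-Reasoning
    eq : ∀ k → 2 * (2 + k) * (2 * (2 + k) + 0) + 2 + (13 * (k * k) + 18 * k)
             ≡ suc (17 * (suc k * suc k))
    eq = solve-∀

-- The exponent `Ω(√n)` is expressed without roots: an exponent `k` with `n ≤ c * k²` is at least
-- `√(n / c)`.
mainTheorem2 : ∃[ c ] ∃[ N ] ((m : ℕ) (f : Form m) → N ≤ nvars f → ZeroNotInIm₂ f →
    (π : TreeRefutation ((f ∷ []) ∷ [])) →
    ∃[ k ] ((2 ^ k ≤ size π) × (nvars f ≤ c * (k * k))))
mainTheorem2 = 17 , 6 , λ m f 6≤n _ π →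
  let k , lower , upper = square-approximation (nvars f) 6≤n
  in suc k , Game.size-lower-bound f (suc k) (initial f (suc k) lower) π (λ ()) , upper
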